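{- For $n\ge1$, $$T_4(\mathcal A_n)=\det(\mathbb I_n+M_n),$$ where $\mathbb I_n$ is the $n\times n$ identity matrix and $M_n$ is the $n\times n$ matrix with entries $(M_n)_{i,j}=\tilde S_{i,j+1}$ for $i,j=0,1,\dots,n-1$.
   Context: A Schröder path here is a lattice path in $\mathbb Z^2$ with steps $(-1,0)$ (left), $(0,1)$ (up) and $(-1,1)$ (diagonal). A restricted Schröder path is a Schröder path whose last step is not an up step. $\tilde S_{i,j}$ denotes the number of restricted Schröder paths from $(i,0)$ to $(0,j)$ (so $\tilde S_{0,j}=0$). A family of paths is non-intersecting if no two of its paths share a vertex. $T_4(\mathcal A_n)$ denotes the number of domino tilings of the $2n\times 2n$ Aztec-like quasi-square domain $\mathcal A_n$ with a central cross-shaped hole that are invariant under quarter-turn rotation about the center; via the standard domino-to-Schröder-path bijection on a fundamental domain, $T_4(\mathcal A_n)$ equals the number of pairs $(I,\mathcal P)$ where $I=\{i_1<\dots<i_\ell\}\subseteq\{0,1,\dots,n-1\}$ (possibly empty) and $\mathcal P$ is a non-intersecting family of restricted Schröder paths, the $k$-th going from $(i_k,0)$ to $(0,i_k+1)$. -}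

module Defs where

open import Data.Nat using (ℕ; zero; suc)
open import Data.Integer using (ℤ; +_; _+_; _-_; _*_; -_)
open import Data.Integer.Properties using () renaming (_≟_ to _≟ℤ_)
open import Data.Fin using (Fin; zero; suc; toℕ; punchIn; _≟_)
open import Data.Product using (Σ; _×_; _,_)
open import Data.Product.Properties using (≡-dec)
open import Data.List using (List; []; _∷_)
open import Data.List.Relation.Unary.All using (All)
open import Data.List.Relation.Unary.AllPairs using (AllPairs)
open import Data.Maybe using (Maybe; just; nothing)
open import Data.Vec using (Vec; []; _∷_)
open import Relation.Binary.PropositionalEquality using (_≡_)
open import Relation.Nullary.Decidable using (False; Dec; yes; no)

data Step : Set where
  L U D : Step

Point : Set
Point = ℤ × ℤ

move : Step → Point → Point
move L (x , y) = (x - + 1 , y)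
move U (x , y) = (x , y + + 1)
move D (x , y) = (x - + 1 , y + + 1)

end : Point → List Step → Point
end p []       = p
end p (s ∷ ss) = end (move s p) ss

vertices : Point → List Step → List Point
vertices p []       = p ∷ []
vertices p (s ∷ ss) = p ∷ vertices (move s p) ss

data LastNotUp : List Step → Set where
  lastL : LastNotUp (L ∷ [])
  lastD : LastNotUp (D ∷ [])
  cons  : ∀ {s ss} → LastNotUp ss → LastNotUp (s ∷ ss)

IsRPath : ℕ → ℕ → List Step → Set
IsRPath i j ss = (end (+ i , + 0) ss ≡ (+ 0 , + j)) × LastNotUp ss

RPath : ℕ → ℕ → Set
RPath i j = Σ (List Step) (IsRPath i j)

_≟ₚ_ : (p q : Point) → Dec (p ≡ q)
_≟ₚ_ = ≡-dec _≟ℤ_ _≟ℤ_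

NoCommonVertex : List Point → List Point → Set
NoCommonVertex xs ys = All (λ x → All (λ y → False (x ≟ₚ y)) ys) xs

-- an element v encodes (I , P): I = {k | v[k] = just _}, and for k ∈ I
-- the k-th path of the family has step sequence v[k], starting at (k,0).
Family : ℕ → Set
Family n = Vec (Maybe (List Step)) n

presentFrom : ∀ {n} → ℕ → Family n → List (ℕ × List Step)
presentFrom m []              = []
presentFrom m (nothing ∷ v)   = presentFrom (suc m) v
presentFrom m (just ss ∷ v)   = (m , ss) ∷ presentFrom (suc m) v

present : ∀ {n} → Family n → List (ℕ × List Step)
present = presentFrom 0

ValidPath : ℕ × List Step → Set
ValidPath (k , ss) = IsRPath k (suc k) ss

NonIntersecting : ℕ × List Step → ℕ × List Step → Set
NonIntersecting (k , ss) (k' , ss') =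
  NoCommonVertex (vertices (+ k , + 0) ss) (vertices (+ k' , + 0) ss')

ValidFamily : ∀ {n} → Family n → Set
ValidFamily v = All ValidPath (present v) × AllPairs NonIntersecting (present v)

-- pairs (I , P) counted by T₄(𝒜ₙ)
Pairs : ℕ → Set
Pairs n = Σ (Family n) ValidFamily

Matrix : ℕ → Set
Matrix n = Fin n → Fin n → ℤ

sumFin : ∀ {n} → (Fin n → ℤ) → ℤ
sumFin {zero}  f = + 0
sumFin {suc n} f = f zero + sumFin (λ i → f (suc i))

sign : ℕ → ℤ
sign zero          = + 1
sign (suc zero)    = - + 1
sign (suc (suc k)) = sign k

det : ∀ n → Matrix n → ℤ
det zero    A = + 1
det (suc n) A =
  sumFin (λ j → sign (toℕ j) * A zero j * det n (λ r c → A (suc r) (punchIn j c)))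

identity : ∀ n → Matrix n
identity n i j with i ≟ j
... | yes _ = + 1
... | no  _ = + 0

IplusM : (ℕ → ℕ → ℕ) → ∀ n → Matrix n
IplusM S n i j = identity n i j + + S (toℕ i) (suc (toℕ j))

{-# OPTIONS --safe #-}
-- Both sides satisfy the same recursion, so neither permutations nor tail swapping are needed.
-- Row i of I + M is e_i plus the row counting the walks from (i , 0); by linearity of the
-- determinant in each row this expands over the subsets I, like the choice of the paths present.
-- Afterwards advance one path at a time by one step, always the innermost among the paths whose
-- current point has the greatest abscissa: no other path can ever visit that point, so the
-- families split according to the step taken, while the determinant splits by linearity in that
-- row. If two current points coincide there are no families left, and two rows are equal.
-- Otherwise the current points stay ordered in both coordinates, and once all of them are on the
-- axis x = 0 either every path is at its own end point and the matrix is the identity, or the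
-- matrix has a zero row or two equal rows.
module Submission where

open import Defs
open import Data.Nat using (ℕ; zero; suc; _≤_; _<_; _∸_; s≤s; z≤n; z<s; s<s⁻¹) renaming (_+_ to _ℕ+_)
import Data.Nat.Properties as ℕ
open import Data.Integer using (ℤ; +_; -[1+_]; _+_; _*_; -_) renaming (_≤_ to _ℤ≤_)
import Data.Integer.Properties as ℤ
open import Data.Integer.Properties using (*-zeroʳ; *-distribˡ-+; neg-distrib-+; +-0-abelianGroup; pos-+)
open import Data.Integer.Tactic.RingSolver using (solve-∀)
open import Algebra.Properties.AbelianGroup +-0-abelianGroup using (identityʳ-unique)
open import Data.Bool.Properties using (T-irrelevant)
open import Data.Fin using (Fin; zero; suc; toℕ; fromℕ<; punchIn; _≟_)
open import Data.Fin.Permutation using (↔⇒≡)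
open import Data.Fin.Properties using (suc-injective; toℕ-injective; toℕ-fromℕ<; toℕ<n; any?; all?; ¬∀⟶∃¬)
open import Data.Empty using (⊥-elim)
open import Data.Product using (Σ; ∃; ∃₂; _×_; _,_; proj₁; proj₂)
open import Data.Sum using (_⊎_; inj₁; inj₂)
open import Data.Maybe as Maybe using (Maybe; just; nothing)
open import Data.Maybe.Properties using (just-injective; map-injective)
open import Data.List using (List; []; _∷_; length; map; _++_) renaming (lookup to lookupₗ)
open import Data.List.Properties using (length-map; length-++; ∷-injectiveˡ; ∷-injectiveʳ)
open import Data.List.Relation.Unary.All as All using (All; []; _∷_)
open import Data.List.Relation.Unary.AllPairs as AllPairs using (AllPairs; []; _∷_)
open import Data.List.Relation.Unary.Any using (here; there; index)
open import Data.List.Relation.Unary.Any.Properties using (lookup-index)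
open import Data.List.Relation.Unary.Unique.Propositional using (Unique)
import Data.List.Relation.Unary.Unique.Propositional.Properties as Unique
open import Data.List.Membership.Propositional using (_∈_; _∉_)
open import Data.List.Membership.Propositional.Properties using (∈-map⁺; ∈-map⁻; ∈-++⁺ˡ; ∈-++⁺ʳ; ∈-++⁻; ∈-lookup)
open import Data.List.Membership.Propositional.Properties.WithK using (unique⇒irrelevant)
open import Data.List.Relation.Binary.Disjoint.Propositional using (Disjoint)
open import Data.Vec using ([]; _∷_; lookup; updateAt; tabulate; _[_]≔_)
open import Data.Vec.Properties using (lookup∘updateAt; lookup∘updateAt′; lookup∘tabulate; tabulate∘lookup; tabulate-cong; updateAt-updateAt-local; updateAt-id-local)
import Data.Vec.Functional as F
import Data.Vec.Functional.Properties as F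
open import Function using (_∘_; id; const)
open import Function.Bundles using (_↔_; mk↔ₛ′)
open import Function.Construct.Composition using (_↔-∘_)
open import Function.Construct.Symmetry using (↔-sym)
open import Relation.Binary.Definitions using (tri<; tri≈; tri>)
open import Relation.Binary.PropositionalEquality
open import Relation.Binary.PropositionalEquality.WithK using (≡-irrelevant)
open import Relation.Nullary using (¬_; Dec; yes; no; contradiction; ¬?)
open import Relation.Nullary.Decidable using (_×-dec_; map′; toWitnessFalse; fromWitnessFalse)
open import Relation.Unary using (Irrelevant)
open ≡-Reasoning

-- Determinants

minor : ∀ {n} → Fin (suc n) → Matrix (suc n) → Matrix n
minor j A r c = A (suc r) (punchIn j c)

sumFin-cong : ∀ {n} {f g : Fin n → ℤ} → (∀ i → f i ≡ g i) → sumFin f ≡ sumFin g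
sumFin-cong {zero}  e = refl
sumFin-cong {suc n} e = cong₂ _+_ (e zero) (sumFin-cong (e ∘ suc))

sumFin-+ : ∀ {n} (f g : Fin n → ℤ) → sumFin (λ i → f i + g i) ≡ sumFin f + sumFin g
sumFin-+ {zero}  f g = refl
sumFin-+ {suc n} f g = trans (cong (_+_ (f zero + g zero)) (sumFin-+ (f ∘ suc) (g ∘ suc)))
  (shuffle (f zero) (g zero) (sumFin (f ∘ suc)) (sumFin (g ∘ suc)))
  where
  shuffle : ∀ a b c d → (a + b) + (c + d) ≡ (a + c) + (b + d)
  shuffle = solve-∀

sumFin-*ˡ : ∀ {n} a (f : Fin n → ℤ) → sumFin (λ i → a * f i) ≡ a * sumFin f
sumFin-*ˡ {zero}  a f = sym (*-zeroʳ a)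
sumFin-*ˡ {suc n} a f = trans (cong (_+_ (a * f zero)) (sumFin-*ˡ a (f ∘ suc)))
  (sym (*-distribˡ-+ a (f zero) (sumFin (f ∘ suc))))

sumFin-neg : ∀ {n} (f : Fin n → ℤ) → sumFin (λ i → - f i) ≡ - sumFin f
sumFin-neg {zero}  f = refl
sumFin-neg {suc n} f = trans (cong (_+_ (- f zero)) (sumFin-neg (f ∘ suc)))
  (sym (neg-distrib-+ (f zero) (sumFin (f ∘ suc))))

sumFin-0 : ∀ {n} {f : Fin n → ℤ} → (∀ i → f i ≡ + 0) → sumFin f ≡ + 0
sumFin-0 {zero}  e = refl
sumFin-0 {suc n} e = cong₂ _+_ (e zero) (sumFin-0 (e ∘ suc))

det-cong : ∀ {n} {A B : Matrix n} → (∀ i j → A i j ≡ B i j) → det n A ≡ det n B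
det-cong {zero}  e = refl
det-cong {suc n} e = sumFin-cong λ j →
  cong₂ _*_ (cong (sign (toℕ j) *_) (e zero j)) (det-cong λ r c → e (suc r) (punchIn j c))

laplace : ∀ {n} → Matrix (suc n) → Fin (suc n) → ℤ
laplace {n} A j = sign (toℕ j) * A zero j * det n (minor j A)

-- Induction on `m`: for the first row the Laplace expansion distributes, for a later row every
-- minor is additive in that row. Three matrices compared entrywise, instead of one matrix with a
-- replaced row, let the lemma apply to rows given in any form.
det-row-+ : ∀ {n} (m : Fin n) {A B C : Matrix n} →
  (∀ j → A m j ≡ B m j + C m j) →
  (∀ i → i ≢ m → ∀ j → A i j ≡ B i j) →
  (∀ i → i ≢ m → ∀ j → A i j ≡ C i j) →
  det n A ≡ det n B + det n C
det-row-+ {suc n} zero {A} {B} {C} e b c = trans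
  (sumFin-cong λ j → begin
    sign (toℕ j) * A zero j * det n (minor j A)
      ≡⟨ cong (λ a → sign (toℕ j) * a * det n (minor j A)) (e j) ⟩
    sign (toℕ j) * (B zero j + C zero j) * det n (minor j A)
      ≡⟨ distrib (sign (toℕ j)) (B zero j) (C zero j) (det n (minor j A)) ⟩
    sign (toℕ j) * B zero j * det n (minor j A) + sign (toℕ j) * C zero j * det n (minor j A)
      ≡⟨ cong₂ (λ x y → sign (toℕ j) * B zero j * x + sign (toℕ j) * C zero j * y)
           (det-cong λ r k → b (suc r) (λ ()) (punchIn j k))
           (det-cong λ r k → c (suc r) (λ ()) (punchIn j k)) ⟩
    sign (toℕ j) * B zero j * det n (minor j B) + sign (toℕ j) * C zero j * det n (minor j C) ∎)
  (sumFin-+ (laplace B) (laplace C))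
  where
  distrib : ∀ s x y d → s * (x + y) * d ≡ s * x * d + s * y * d
  distrib = solve-∀
det-row-+ {suc n} (suc m) {A} {B} {C} e b c = trans
  (sumFin-cong λ j → begin
    sign (toℕ j) * A zero j * det n (minor j A)
      ≡⟨ cong (sign (toℕ j) * A zero j *_) (det-row-+ m (λ k → e (punchIn j k))
           (λ i i≢m k → b (suc i) (i≢m ∘ suc-injective) (punchIn j k))
           (λ i i≢m k → c (suc i) (i≢m ∘ suc-injective) (punchIn j k))) ⟩
    sign (toℕ j) * A zero j * (det n (minor j B) + det n (minor j C))
      ≡⟨ *-distribˡ-+ (sign (toℕ j) * A zero j) (det n (minor j B)) (det n (minor j C)) ⟩
    sign (toℕ j) * A zero j * det n (minor j B) + sign (toℕ j) * A zero j * det n (minor j C)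
      ≡⟨ cong₂ (λ x y → sign (toℕ j) * x * det n (minor j B) + sign (toℕ j) * y * det n (minor j C))
           (b zero (λ ()) j) (c zero (λ ()) j) ⟩
    sign (toℕ j) * B zero j * det n (minor j B) + sign (toℕ j) * C zero j * det n (minor j C) ∎)
  (sumFin-+ (laplace B) (laplace C))

-- A zero row is the sum of itself and itself, so additivity gives `d ≡ d + d` for the determinant
-- `d`.
det-zero-row : ∀ {n} (m : Fin n) {A : Matrix n} → (∀ j → A m j ≡ + 0) → det n A ≡ + 0
det-zero-row {n} m {A} z = identityʳ-unique (det n A) (det n A) (sym (det-row-+ m
  (λ j → trans (z j) (sym (cong₂ _+_ (z j) (z j)))) (λ _ _ _ → refl) (λ _ _ _ → refl)))

sign-suc : ∀ k → sign (suc k) ≡ - sign k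
sign-suc zero          = refl
sign-suc (suc zero)    = refl
sign-suc (suc (suc k)) = sign-suc k

-- X j k stands for the minor of the remaining rows that avoids the columns j
-- and punchIn j k, so it is invariant under naming these columns in the other order.
PairInvariant : ∀ {n} → (Fin (suc n) → Fin n → ℤ) → Set
PairInvariant {n} X = ∀ j k j′ k′ → j′ ≡ punchIn j k → j ≡ punchIn j′ k′ → X j k ≡ X j′ k′

-- The Laplace expansion along two rows `u` and `v` at once, with `X` in place of the complementary
-- minors.
expand₂ : ∀ {n} → (u v : Fin (suc n) → ℤ) → (Fin (suc n) → Fin n → ℤ) → ℤ
expand₂ u v X = sumFin λ j → sumFin λ k →
  sign (toℕ j) * u j * (sign (toℕ k) * v (punchIn j k) * X j k)

-- Splitting off column `zero` leaves three parts: the terms with `j = zero`, the terms with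
-- `k = zero`, which carry the opposite sign, and the same double sum with one column fewer, where
-- two sign changes cancel. Exchanging the rows swaps the first two parts up to sign; induction
-- handles the third.
expand₂-swap : ∀ {n} (u v : Fin (suc n) → ℤ) X → PairInvariant X →
  expand₂ u v X ≡ - expand₂ v u X
expand₂-swap {zero}  u v X inv = refl
expand₂-swap {suc n} u v X inv = begin
  expand₂ u v X                                     ≡⟨ split u v ⟩
  edge u v + (- edge v u + expand₂ (u ∘ suc) (v ∘ suc) X′)
    ≡⟨ cong (λ z → edge u v + (- edge v u + z)) (expand₂-swap (u ∘ suc) (v ∘ suc) X′ inv′) ⟩
  edge u v + (- edge v u + - expand₂ (v ∘ suc) (u ∘ suc) X′)
    ≡⟨ flip (edge u v) (edge v u) (expand₂ (v ∘ suc) (u ∘ suc) X′) ⟩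
  - (edge v u + (- edge u v + expand₂ (v ∘ suc) (u ∘ suc) X′)) ≡⟨ cong -_ (split v u) ⟨
  - expand₂ v u X ∎
  where
  X′ : Fin (suc n) → Fin n → ℤ
  X′ j k = X (suc j) (suc k)
  inv′ : PairInvariant X′
  inv′ j k j′ k′ p q = inv (suc j) (suc k) (suc j′) (suc k′) (cong suc p) (cong suc q)
  term : (u v : Fin (suc (suc n)) → ℤ) → Fin (suc (suc n)) → Fin (suc n) → ℤ
  term u v j k = sign (toℕ j) * u j * (sign (toℕ k) * v (punchIn j k) * X j k)
  edge : (u v : Fin (suc (suc n)) → ℤ) → ℤ
  edge u v = sumFin λ k → sign (toℕ k) * u zero * v (suc k) * X zero k
  flip : ∀ a b c → a + (- b + - c) ≡ - (b + (- a + c))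
  flip = solve-∀
  first : ∀ s a b x → + 1 * a * (s * b * x) ≡ s * a * b * x
  first = solve-∀
  second : ∀ s a b x → - s * a * (+ 1 * b * x) ≡ - (s * b * a * x)
  second = solve-∀
  rest : ∀ s t a b x → - s * a * (- t * b * x) ≡ s * a * (t * b * x)
  rest = solve-∀
  split : ∀ u v → expand₂ u v X ≡ edge u v + (- edge v u + expand₂ (u ∘ suc) (v ∘ suc) X′)
  split u v = cong₂ _+_
    (sumFin-cong λ k → first (sign (toℕ k)) (u zero) (v (suc k)) (X zero k))
    (trans (sumFin-+ (λ j → term u v (suc j) zero) (λ j → sumFin λ k → term u v (suc j) (suc k))) (cong₂ _+_
      -- `X (suc j) zero` and `X zero j` avoid the same two columns, `zero` and `suc j`, so
      -- invariance turns these terms into those of `edge v u`.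
      (trans (sumFin-cong λ j → trans
                (cong₂ (λ s x → s * u (suc j) * (+ 1 * v zero * x))
                  (sign-suc (toℕ j)) (inv (suc j) zero zero j refl refl))
                (second (sign (toℕ j)) (u (suc j)) (v zero) (X zero j)))
             (sumFin-neg λ j → sign (toℕ j) * v zero * u (suc j) * X zero j))
      (sumFin-cong λ j → sumFin-cong λ k → trans
        (cong₂ (λ s t → s * u (suc j) * (t * v (suc (punchIn j k)) * X′ j k))
          (sign-suc (toℕ j)) (sign-suc (toℕ k)))
        (rest (sign (toℕ j)) (sign (toℕ k)) (u (suc j)) (v (suc (punchIn j k))) (X′ j k)))))

-- Both sides list the columns other than `j` and `j′` in increasing order.
punchIn-exchange : ∀ {n} (j : Fin (suc (suc n))) k j′ k′ → j′ ≡ punchIn j k → j ≡ punchIn j′ k′ →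
  ∀ c → punchIn j (punchIn k c) ≡ punchIn j′ (punchIn k′ c)
punchIn-exchange zero k _ zero refl q c = refl
punchIn-exchange (suc j) zero _ k′ refl q c = cong (λ z → suc (punchIn z c)) (suc-injective q)
punchIn-exchange (suc j) (suc k) _ (suc k′) refl q zero = refl
punchIn-exchange (suc j) (suc k) _ (suc k′) refl q (suc c) =
  cong suc (punchIn-exchange j k _ k′ refl (suc-injective q) c)

swap₀₁ : ∀ {n} → Matrix (suc (suc n)) → Matrix (suc (suc n))
swap₀₁ A zero          = A (suc zero)
swap₀₁ A (suc zero)    = A zero
swap₀₁ A (suc (suc i)) = A (suc (suc i))

det-swap₀₁ : ∀ {n} (A : Matrix (suc (suc n))) → det _ A ≡ - det _ (swap₀₁ A)
det-swap₀₁ {n} A = begin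
  det _ A                              ≡⟨ expand A ⟩
  expand₂ (A zero) (A (suc zero)) X    ≡⟨ expand₂-swap (A zero) (A (suc zero)) X inv ⟩
  - expand₂ (A (suc zero)) (A zero) X  ≡⟨ cong -_ (expand (swap₀₁ A)) ⟨
  - det _ (swap₀₁ A)                   ∎
  where
  X : Fin (suc (suc n)) → Fin (suc n) → ℤ
  X j k = det n (minor k (minor j A))
  inv : PairInvariant X
  inv j k j′ k′ p q = det-cong λ r c → cong (A (suc (suc r))) (punchIn-exchange j k j′ k′ p q c)
  expand : ∀ B → det _ B ≡ expand₂ (B zero) (B (suc zero)) (λ j k → det n (minor k (minor j B)))
  expand B = sumFin-cong λ j → sym (sumFin-*ˡ (sign (toℕ j) * B zero j) (laplace (minor j B)))

self-neg⇒0 : ∀ a → a ≡ - a → a ≡ + 0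
self-neg⇒0 (+ zero) e = refl
self-neg⇒0 (+ suc n) ()

det-minors-0 : ∀ {n} (A : Matrix (suc n)) → (∀ j → det n (minor j A) ≡ + 0) → det (suc n) A ≡ + 0
det-minors-0 A z = sumFin-0 λ j →
  trans (cong (sign (toℕ j) * A zero j *_) (z j)) (*-zeroʳ (sign (toℕ j) * A zero j))

-- If the equal rows are the first two, swapping them negates the determinant and leaves the matrix
-- unchanged. Otherwise the swap moves the first row to second place, so both equal rows survive in
-- every minor and induction applies there.
det-equal-rows₀ : ∀ {n} (A : Matrix (suc n)) (b : Fin n) → (∀ j → A zero j ≡ A (suc b) j) → det _ A ≡ + 0
det-equal-rows₀ {suc n} A zero e =
  self-neg⇒0 _ (trans (det-swap₀₁ A) (cong -_ (det-cong {A = swap₀₁ A} {A} λ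
    { zero j → sym (e j) ; (suc zero) j → e j ; (suc (suc i)) j → refl })))
det-equal-rows₀ {suc n} A (suc b) e =
  trans (det-swap₀₁ A) (cong -_ (det-minors-0 (swap₀₁ A) λ j →
    det-equal-rows₀ (minor j (swap₀₁ A)) b (λ k → e (punchIn j k))))

det-equal-rows : ∀ {n} (A : Matrix n) (a b : Fin n) → a ≢ b → (∀ j → A a j ≡ A b j) → det n A ≡ + 0
det-equal-rows A zero    zero    a≢b e = ⊥-elim (a≢b refl)
det-equal-rows A zero    (suc b) a≢b e = det-equal-rows₀ A b e
det-equal-rows A (suc a) zero    a≢b e = det-equal-rows₀ A a (sym ∘ e)
det-equal-rows A (suc a) (suc b) a≢b e = det-minors-0 A λ j →
  det-equal-rows (minor j A) a b (a≢b ∘ cong suc) (λ k → e (punchIn j k))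

det-identity : ∀ n → det n (identity n) ≡ + 1
det-identity zero    = refl
det-identity (suc n) = cong₂ _+_
  (cong (+ 1 * + 1 *_) (trans (det-cong {A = minor zero (identity (suc n))} {identity n} minor-identity) (det-identity n)))
  (sumFin-0 λ j → trans (cong (_* det n (minor (suc j) (identity (suc n)))) (*-zeroʳ (sign (suc (toℕ j))))) refl)
  where
  minor-identity : ∀ i j → identity (suc n) (suc i) (suc j) ≡ identity n i j
  minor-identity i j with i ≟ j
  ... | yes _ = refl
  ... | no  _ = refl

-- Counting by duplicate-free lists

-- The enumeration lists raw elements without their proofs of `P`, so that unions and images can be
-- counted before any proof irrelevance is needed.
record Count {A : Set} (P : A → Set) (c : ℕ) : Set where
  field
    elements : List A
    size     : length elements ≡ c
    unique   : Unique elements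
    sound    : ∀ {x} → x ∈ elements → P x
    complete : ∀ {x} → P x → x ∈ elements

open Count

module _ {A : Set} where

  count-⇔ : ∀ {P Q : A → Set} {c} → (∀ {x} → P x → Q x) → (∀ {x} → Q x → P x) → Count P c → Count Q c
  count-⇔ to from P .elements   = P .elements
  count-⇔ to from P .size       = P .size
  count-⇔ to from P .unique     = P .unique
  count-⇔ to from P .sound      = to ∘ P .sound
  count-⇔ to from P .complete   = P .complete ∘ from

  count-none : ∀ {P : A → Set} → (∀ {x} → ¬ P x) → Count P 0
  count-none ¬P .elements  = []
  count-none ¬P .size      = refl
  count-none ¬P .unique    = []
  count-none ¬P .sound     ()
  count-none ¬P .complete  = ⊥-elim ∘ ¬P

  count-one : ∀ {P : A → Set} a → P a → (∀ {x} → P x → x ≡ a) → Count P 1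
  count-one a Pa only .elements         = a ∷ []
  count-one a Pa only .size             = refl
  count-one a Pa only .unique           = [] ∷ []
  count-one a Pa only .sound (here refl) = Pa
  count-one a Pa only .complete         = here ∘ only

  count-⊎ : ∀ {P Q : A → Set} {a b} → (∀ {x} → P x → ¬ Q x) → Count P a → Count Q b →
    Count (λ x → P x ⊎ Q x) (a ℕ+ b)
  count-⊎ apart P Q .elements = P .elements ++ Q .elements
  count-⊎ apart P Q .size     = trans (length-++ (P .elements)) (cong₂ _ℕ+_ (P .size) (Q .size))
  count-⊎ apart P Q .unique   = Unique.++⁺ (P .unique) (Q .unique) λ (p , q) → apart (P .sound p) (Q .sound q)
  count-⊎ apart P Q .sound m with ∈-++⁻ (P .elements) m
  ... | inj₁ p = inj₁ (P .sound p)
  ... | inj₂ q = inj₂ (Q .sound q)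
  count-⊎ apart P Q .complete (inj₁ p) = ∈-++⁺ˡ (P .complete p)
  count-⊎ apart P Q .complete (inj₂ q) = ∈-++⁺ʳ (P .elements) (Q .complete q)

  count-image : ∀ {B : Set} {P : A → Set} {c} (f : A → B) → (∀ {x y} → f x ≡ f y → x ≡ y) →
    Count P c → Count (λ y → ∃ λ x → y ≡ f x × P x) c
  count-image f inj P .elements = map f (P .elements)
  count-image f inj P .size     = trans (length-map f (P .elements)) (P .size)
  count-image f inj P .unique   = Unique.map⁺ inj (P .unique)
  count-image f inj P .sound m with ∈-map⁻ f m
  ... | x , x∈ , y≡ = x , y≡ , P .sound x∈
  count-image f inj P .complete (x , refl , p) = ∈-map⁺ f (P .complete p)

  index-∈-lookup : ∀ (xs : List A) i → index (∈-lookup {xs = xs} i) ≡ i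
  index-∈-lookup (x ∷ xs) zero    = refl
  index-∈-lookup (x ∷ xs) (suc i) = cong suc (index-∈-lookup xs i)

  -- Irrelevance of `P` makes positions in the list correspond to elements of `Σ A P`; two finite
  -- types in bijection have the same size.
  count-↔ : ∀ {P : A → Set} {c t} → Irrelevant P → Count P c → Fin t ↔ Σ A P → t ≡ c
  count-↔ {P} {t = t} irr C f = trans (↔⇒≡ (↔-sym enumeration ↔-∘ f)) (C .size)
    where
    enumeration : Fin (length (C .elements)) ↔ Σ A P
    enumeration = mk↔ₛ′
      (λ i → lookupₗ (C .elements) i , C .sound (∈-lookup i))
      (λ (x , p) → index (C .complete p))
      (λ (x , p) → Σ-≡ (sym (lookup-index (C .complete p))))
      (λ i → trans (cong index (unique⇒irrelevant (C .unique) _ _)) (index-∈-lookup (C .elements) i))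
      where
      Σ-≡ : ∀ {x y p q} → x ≡ y → _≡_ {A = Σ A P} (x , p) (y , q)
      Σ-≡ {p = p} {q} refl = cong (_ ,_) (irr p q)

-- Restricted Schröder paths

-- A restricted path stops at its first visit to the line x = 0, hence done needs no extra condition on its last step.
data Walk : ℕ → ℕ → ℕ → List Step → Set where
  done : ∀ {j} → Walk 0 j j []
  left : ∀ {x y j ss} → Walk x y j ss → Walk (suc x) y j (L ∷ ss)
  up   : ∀ {x y j ss} → Walk (suc x) (suc y) j ss → Walk (suc x) y j (U ∷ ss)
  diag : ∀ {x y j ss} → Walk x (suc y) j ss → Walk (suc x) y j (D ∷ ss)

walk-≤ : ∀ {x y j ss} → Walk x y j ss → y ≤ j
walk-≤ done     = ℕ.≤-refl
walk-≤ (left w) = walk-≤ w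
walk-≤ (up w)   = ℕ.<⇒≤ (walk-≤ w)
walk-≤ (diag w) = ℕ.<⇒≤ (walk-≤ w)

-- The number of walks from abscissa `x` that still have to rise by `h`, by first step. The value 0
-- at `zero`, `suc h` reflects that a walk stops on reaching the axis.
schröder : ℕ → ℕ → ℕ
schröder zero    zero    = 1
schröder zero    (suc h) = 0
schröder (suc x) zero    = schröder x zero
schröder (suc x) (suc h) = schröder (suc x) h ℕ+ (schröder x (suc h) ℕ+ schröder x h)

-- The walks split by their first letter into disjoint images. With no rise left, an up or diagonal
-- step would overshoot the target, so only `left` remains.
count-walk : ∀ x h {y j} → h ℕ+ y ≡ j → Count (Walk x y j) (schröder x h)
count-walk zero    zero    refl = count-one [] done λ { done → refl }
count-walk zero    (suc h) e    = count-none λ { done → ℕ.m≢1+n+m _ (sym e) }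
count-walk (suc x) zero    refl = count-⇔
  (λ { (_ , refl , w) → left w })
  (λ { (left w) → _ , refl , w
     ; (up w) → ⊥-elim (ℕ.1+n≰n (walk-≤ w))
     ; (diag w) → ⊥-elim (ℕ.1+n≰n (walk-≤ w)) })
  (count-image (L ∷_) ∷-injectiveʳ (count-walk x zero refl))
count-walk (suc x) (suc h) {y} e = count-⇔
  (λ { (inj₁ (_ , refl , w)) → up w
     ; (inj₂ (inj₁ (_ , refl , w))) → left w
     ; (inj₂ (inj₂ (_ , refl , w))) → diag w })
  (λ { (up w) → inj₁ (_ , refl , w)
     ; (left w) → inj₂ (inj₁ (_ , refl , w))
     ; (diag w) → inj₂ (inj₂ (_ , refl , w)) })
  (count-⊎ (λ { (_ , refl , _) (inj₁ (_ , () , _)) ; (_ , refl , _) (inj₂ (_ , () , _)) })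
    (count-image (U ∷_) ∷-injectiveʳ (count-walk (suc x) h e′))
    (count-⊎ (λ { (_ , refl , _) (_ , () , _) })
      (count-image (L ∷_) ∷-injectiveʳ (count-walk x (suc h) e))
      (count-image (D ∷_) ∷-injectiveʳ (count-walk x h e′))))
  where
  e′ : h ℕ+ suc y ≡ _
  e′ = trans (ℕ.+-suc h y) e

-- This is `schröder x` at the difference of `j` and `y`, but 0 when `j < y`, where truncated
-- subtraction would give a wrong positive count.
paths : ℕ → ℕ → ℕ → ℕ
paths x zero    j       = schröder x j
paths x (suc y) zero    = 0
paths x (suc y) (suc j) = paths x y j

-- The summands belong to the steps up, left and diagonal. The identity holds for every target
-- height `j`, also at or below `y`, and hence for a whole matrix row at once.
paths-step : ∀ x y j → paths (suc x) y j ≡ paths (suc x) (suc y) j ℕ+ (paths x y j ℕ+ paths x (suc y) j)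
paths-step x zero    zero    = sym (ℕ.+-identityʳ _)
paths-step x zero    (suc j) = refl
paths-step x (suc y) zero    = refl
paths-step x (suc y) (suc j) = paths-step x y j

paths-above : ∀ x {y j} → j < y → paths x y j ≡ 0
paths-above x {suc y} {zero}  _         = refl
paths-above x {suc y} {suc j} (s≤s j<y) = paths-above x j<y

paths-end : ∀ j → paths 0 j j ≡ 1
paths-end zero    = refl
paths-end (suc j) = paths-end j

paths-off : ∀ {y j} → y ≢ j → paths 0 y j ≡ 0
paths-off {zero}  {zero}  e = ⊥-elim (e refl)
paths-off {zero}  {suc j} e = refl
paths-off {suc y} {zero}  e = refl
paths-off {suc y} {suc j} e = paths-off (e ∘ cong suc)

pt : ℕ → ℕ → Point
pt x y = + x , + y

move-up : ∀ x y → move U (pt x y) ≡ pt x (suc y)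
move-up x y = cong (λ z → + x , + z) (ℕ.+-comm y 1)

pt-injective : ∀ {x y x′ y′} → pt x y ≡ pt x′ y′ → x ≡ x′ × y ≡ y′
pt-injective refl = refl , refl

end-x≤ : ∀ p ss → proj₁ (end p ss) ℤ≤ proj₁ p
end-x≤ p []             = ℤ.≤-refl
end-x≤ p@(x , y) (L ∷ ss) = ℤ.≤-trans (end-x≤ (move L p) ss) (ℤ.i-j≤i x (+ 1))
end-x≤ p (U ∷ ss)       = end-x≤ (move U p) ss
end-x≤ p@(x , y) (D ∷ ss) = ℤ.≤-trans (end-x≤ (move D p) ss) (ℤ.i-j≤i x (+ 1))

no-return : ∀ {y z ss} → end (-[1+ 0 ] , y) ss ≢ (+ 0 , z)
no-return {y} {z} {ss} e with end (-[1+ 0 ] , y) ss | end-x≤ (-[1+ 0 ] , y) ss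
no-return refl | _ | ()

-- A left or diagonal step from the axis leads to a negative abscissa, from which there is no
-- return. Hence all steps are up steps, including the last.
no-restricted-from-axis : ∀ {y z ss} → end (+ 0 , y) ss ≡ (+ 0 , z) → ¬ LastNotUp ss
no-restricted-from-axis {ss = L ∷ ss} e l        = no-return {ss = ss} e
no-restricted-from-axis {ss = U ∷ ss} e (cons l) = no-restricted-from-axis {ss = ss} e l
no-restricted-from-axis {ss = D ∷ ss} e l        = no-return {ss = ss} e

walk-done : ∀ {x y j} → pt x y ≡ pt 0 j → Walk x y j []
walk-done refl = done

restricted⇒walk : ∀ x {y j ss} → end (pt x y) ss ≡ pt 0 j → LastNotUp ss → Walk x y j ss
restricted⇒walk zero {ss = ss} e l = ⊥-elim (no-restricted-from-axis {ss = ss} e l)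
restricted⇒walk (suc x) e lastL = left (walk-done e)
restricted⇒walk (suc x) {y} e lastD = diag (walk-done (trans (sym (move-up x y)) e))
restricted⇒walk (suc x) {ss = L ∷ ss} e (cons l) = left (restricted⇒walk x e l)
restricted⇒walk (suc x) {y} {ss = U ∷ ss} e (cons l) =
  up (restricted⇒walk (suc x) (trans (cong (λ p → end p ss) (sym (move-up (suc x) y))) e) l)
restricted⇒walk (suc x) {y} {ss = D ∷ ss} e (cons l) =
  diag (restricted⇒walk x (trans (cong (λ p → end p ss) (sym (move-up x y))) e) l)

walk-end : ∀ {x y j ss} → Walk x y j ss → end (pt x y) ss ≡ pt 0 j
walk-end done = refl
walk-end (left w) = walk-end w
walk-end {suc x} {y} {ss = U ∷ ss} (up w) = trans (cong (λ p → end p ss) (move-up (suc x) y)) (walk-end w)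
walk-end {suc x} {y} {ss = D ∷ ss} (diag w) = trans (cong (λ p → end p ss) (move-up x y)) (walk-end w)

-- Starting off the axis, a walk can reach it only by a left or diagonal step, and there it stops.
walk-lastNotUp : ∀ {x y j ss} → Walk (suc x) y j ss → LastNotUp ss
walk-lastNotUp (left {zero} done)  = lastL
walk-lastNotUp (left {suc x} w)    = cons (walk-lastNotUp w)
walk-lastNotUp (up w)              = cons (walk-lastNotUp w)
walk-lastNotUp (diag {zero} done)  = lastD
walk-lastNotUp (diag {suc x} w)    = cons (walk-lastNotUp w)

rpath⇒walk : ∀ {i j ss} → IsRPath i j ss → Walk i 0 j ss
rpath⇒walk {i} (e , l) = restricted⇒walk i e l

walk⇒rpath : ∀ {i j ss} → Walk i 0 (suc j) ss → IsRPath i (suc j) ss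
-- No walk leads from the origin to a positive height, so abscissa `zero` leaves no case.
walk⇒rpath {suc i} w = walk-end w , walk-lastNotUp w

LastNotUp-irrelevant : Irrelevant LastNotUp
LastNotUp-irrelevant lastL    lastL     = refl
LastNotUp-irrelevant lastD    lastD     = refl
LastNotUp-irrelevant (cons p) (cons q)  = cong cons (LastNotUp-irrelevant p q)

IsRPath-irrelevant : ∀ {i j} → Irrelevant (IsRPath i j)
IsRPath-irrelevant (e , l) (e′ , l′) = cong₂ _,_ (≡-irrelevant e e′) (LastNotUp-irrelevant l l′)

count-rpath : ∀ i j → Count (IsRPath i (suc j)) (paths i 0 (suc j))
count-rpath i j = count-⇔ walk⇒rpath rpath⇒walk (count-walk i (suc j) (ℕ.+-identityʳ (suc j)))

-- Steps never go right or down. This confines a path to the quadrant left of and above its current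
-- point.
walk-bounds : ∀ {x y j ss v} → Walk x y j ss → v ∈ vertices (pt x y) ss →
  ∃₂ λ a b → v ≡ pt a b × a ≤ x × y ≤ b
walk-bounds done (here refl) = _ , _ , refl , ℕ.≤-refl , ℕ.≤-refl
walk-bounds (left w) (here refl) = _ , _ , refl , ℕ.≤-refl , ℕ.≤-refl
walk-bounds (up w) (here refl) = _ , _ , refl , ℕ.≤-refl , ℕ.≤-refl
walk-bounds (diag w) (here refl) = _ , _ , refl , ℕ.≤-refl , ℕ.≤-refl
walk-bounds (left w) (there m) with walk-bounds w m
... | a , b , e , a≤ , ≤b = a , b , e , ℕ.m≤n⇒m≤1+n a≤ , ≤b
walk-bounds {suc x} {y} {ss = U ∷ ss} {v} (up w) (there m)
  with walk-bounds w (subst (λ p → v ∈ vertices p ss) (move-up (suc x) y) m)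
... | a , b , e , a≤ , ≤b = a , b , e , a≤ , ℕ.<⇒≤ ≤b
walk-bounds {suc x} {y} {ss = D ∷ ss} {v} (diag w) (there m)
  with walk-bounds w (subst (λ p → v ∈ vertices p ss) (move-up x y) m)
... | a , b , e , a≤ , ≤b = a , b , e , ℕ.m≤n⇒m≤1+n a≤ , ℕ.<⇒≤ ≤b

-- Partially advanced systems of paths

-- The state of index k: undecided means that its membership in I is still open, and at x y that its path
-- has reached (x , y); a family then records only the steps from there on.
data Node : Set where
  undecided absent : Node
  at               : ℕ → ℕ → Node

State : ℕ → Set
State n = Fin n → Node

-- The row of `undecided` is the sum of the rows of `absent` and of `at` the starting point. Column
-- `j` belongs to the end point at height `suc j`.
row : ∀ {n} → Fin n → Node → Fin n → ℤ
row i undecided j = identity _ i j + + paths (toℕ i) 0 (suc (toℕ j))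
row i absent    j = identity _ i j
row i (at x y)  j = + paths x y (suc (toℕ j))

rows : ∀ {n} → State n → Matrix n
rows st i = row i (st i)

data Fits (i : ℕ) : Node → Maybe (List Step) → Set where
  leave  : Fits i undecided nothing
  enter  : ∀ {ss} → Walk i 0 (suc i) ss → Fits i undecided (just ss)
  absent : Fits i absent nothing
  at     : ∀ {x y ss} → Walk x y (suc i) ss → Fits i (at x y) (just ss)

source : ℕ → Node → Point
source i (at x y) = pt x y
source i _        = pt i 0

visited : ℕ → Node → Maybe (List Step) → List Point
visited i nd nothing   = []
visited i nd (just ss) = vertices (source i nd) ss

visits : ∀ {n} → State n → Family n → Fin n → List Point
visits st v i = visited (toℕ i) (st i) (lookup v i)

record Valid {n} (st : State n) (v : Family n) : Set where
  field
    fits  : ∀ i → Fits (toℕ i) (st i) (lookup v i)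
    apart : ∀ {i k} → i ≢ k → Disjoint (visits st v i) (visits st v k)

open Valid

-- The invariant of the whole recursion: each move between states splits the families and the
-- determinant in the same way.
Counted : ∀ {n} → State n → Set
Counted {n} st = ∃ λ c → Count (Valid st) c × + c ≡ det n (rows st)

infixl 6 _[_↦_]
_[_↦_] : ∀ {n} → State n → Fin n → Node → State n
st [ m ↦ nd ] = F.updateAt st m (const nd)

[↦]-here : ∀ {n} (st : State n) m {nd} → (st [ m ↦ nd ]) m ≡ nd
[↦]-here st m = F.updateAt-updates m st

[↦]-there : ∀ {n} (st : State n) {m nd} i → i ≢ m → (st [ m ↦ nd ]) i ≡ st i
[↦]-there st {m} i i≢m = F.updateAt-minimal i m st i≢m

-- Every move of the recursion alters one index only, so just the conditions involving `m` have to
-- be checked again.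
valid-transfer : ∀ {n} {st st′ : State n} {v v′} m →
  (∀ i → i ≢ m → st′ i ≡ st i) → (∀ i → i ≢ m → lookup v′ i ≡ lookup v i) →
  Fits (toℕ m) (st′ m) (lookup v′ m) →
  (∀ k → k ≢ m → Disjoint (visits st′ v′ m) (visits st v k)) →
  Valid st v → Valid st′ v′
valid-transfer {st = st} {st′} {v} {v′} m eqˢ eqᵛ fit-m apart-m V = record { fits = fits′ ; apart = apart′ }
  where
  fits′ : ∀ i → Fits (toℕ i) (st′ i) (lookup v′ i)
  fits′ i with i ≟ m
  ... | yes refl = fit-m
  ... | no i≢m = subst₂ (Fits (toℕ i)) (sym (eqˢ i i≢m)) (sym (eqᵛ i i≢m)) (V .fits i)
  same : ∀ {i} → i ≢ m → visits st′ v′ i ≡ visits st v i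
  same {i} i≢m = cong₂ (visited (toℕ i)) (eqˢ i i≢m) (eqᵛ i i≢m)
  apart′ : ∀ {i k} → i ≢ k → Disjoint (visits st′ v′ i) (visits st′ v′ k)
  apart′ {i} {k} i≢k {p} (∈i , ∈k) with i ≟ m | k ≟ m
  ... | yes refl | yes refl = i≢k refl
  ... | yes refl | no k≢m   = apart-m k k≢m (∈i , subst (p ∈_) (same k≢m) ∈k)
  ... | no i≢m   | yes refl = apart-m i i≢m (∈k , subst (p ∈_) (same i≢m) ∈i)
  ... | no i≢m   | no k≢m   = V .apart i≢k (subst (p ∈_) (same i≢m) ∈i , subst (p ∈_) (same k≢m) ∈k)

det-split : ∀ {n} (st : State n) m {a b} → (∀ j → rows st m j ≡ row m a j + row m b j) →
  det n (rows st) ≡ det n (rows (st [ m ↦ a ])) + det n (rows (st [ m ↦ b ]))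
det-split st m e = det-row-+ m
  (λ j → trans (e j) (sym (cong₂ (λ a b → row m a j + row m b j) ([↦]-here st m) ([↦]-here st m))))
  (λ i i≢m j → cong (λ nd → row i nd j) (sym ([↦]-there st i i≢m)))
  (λ i i≢m j → cong (λ nd → row i nd j) (sym ([↦]-there st i i≢m)))

-- Leaving `m` out of I corresponds to the identity summand of row `m`, putting it in to the
-- walk-counting summand.
counted-undecided : ∀ {n} (st : State n) m → st m ≡ undecided →
  Counted (st [ m ↦ absent ]) → Counted (st [ m ↦ at (toℕ m) 0 ]) → Counted st
counted-undecided {n} st m st-m (a , A , detA) (b , B , detB) = a ℕ+ b ,
  count-⇔ (λ { (inj₁ V) → left-out V ; (inj₂ V) → entered V }) decide
    (count-⊎ (λ V W → clash (fits-m V) (fits-m W)) A B) ,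
  trans (pos-+ a b) (trans (cong₂ _+_ detA detB)
    (sym (det-split st m λ j → cong (λ nd → row m nd j) st-m)))
  where
  fits-m : ∀ {nd v} → Valid (st [ m ↦ nd ]) v → Fits (toℕ m) nd (lookup v m)
  fits-m V = subst (λ nd → Fits _ nd _) ([↦]-here st m) (V .fits m)
  clash : ∀ {i x y c} → Fits i absent c → ¬ Fits i (at x y) c
  clash absent ()
  change : ∀ {nd nd′ v} {st st′ : State n} → st m ≡ nd → st′ m ≡ nd′ → (∀ i → i ≢ m → st′ i ≡ st i) →
    Fits (toℕ m) nd′ (lookup v m) → visited (toℕ m) nd′ (lookup v m) ≡ visited (toℕ m) nd (lookup v m) →
    Valid st v → Valid st′ v
  change refl refl eq f same V = valid-transfer m eq (λ _ _ → refl) f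
    (λ k k≢m {p} (∈m , ∈k) → V .apart (k≢m ∘ sym) (subst (p ∈_) same ∈m , ∈k)) V
  left-out : ∀ {v} → Valid (st [ m ↦ absent ]) v → Valid st v
  left-out {v} V = change ([↦]-here st m) st-m (λ i i≢m → sym ([↦]-there st i i≢m)) (f (fits-m V)) (g (fits-m V)) V
    where
    f : ∀ {i c} → Fits i absent c → Fits i undecided c
    f absent = leave
    g : ∀ {i c} → Fits i absent c → visited i undecided c ≡ visited i absent c
    g absent = refl
  entered : ∀ {v} → Valid (st [ m ↦ at (toℕ m) 0 ]) v → Valid st v
  entered {v} V = change ([↦]-here st m) st-m (λ i i≢m → sym ([↦]-there st i i≢m)) (f (fits-m V)) (g (fits-m V)) V
    where
    f : ∀ {i c} → Fits i (at i 0) c → Fits i undecided c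
    f (at w) = enter w
    g : ∀ {i c} → Fits i (at i 0) c → visited i undecided c ≡ visited i (at i 0) c
    g (at w) = refl
  decide : ∀ {v} → Valid st v → Valid (st [ m ↦ absent ]) v ⊎ Valid (st [ m ↦ at (toℕ m) 0 ]) v
  decide {v} V with lookup v m in v-m | subst (λ nd → Fits (toℕ m) nd (lookup v m)) st-m (V .fits m)
  ... | nothing | leave = inj₁ (change st-m ([↦]-here st m) ([↦]-there st)
          (subst (Fits _ _) (sym v-m) absent) (trans (cong (visited _ absent) v-m) (sym (cong (visited _ undecided) v-m))) V)
  ... | just ss | enter w = inj₂ (change st-m ([↦]-here st m) ([↦]-there st)
          (subst (Fits _ _) (sym v-m) (at w)) (trans (cong (visited _ (at _ 0)) v-m) (sym (cong (visited _ undecided) v-m))) V)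

-- Advancing the leading path by one step

data Advance : Step → ℕ → ℕ → ℕ → ℕ → Set where
  left : ∀ {x y} → Advance L (suc x) y x y
  up   : ∀ {x y} → Advance U (suc x) y (suc x) (suc y)
  diag : ∀ {x y} → Advance D (suc x) y x (suc y)

advance-move : ∀ {s x y x′ y′} → Advance s x y x′ y′ → move s (pt x y) ≡ pt x′ y′
advance-move left           = refl
advance-move (up {x} {y})   = move-up (suc x) y
advance-move (diag {x} {y}) = move-up x y

advance-walk : ∀ {s x y x′ y′ j ss} → Advance s x y x′ y′ → Walk x′ y′ j ss → Walk x y j (s ∷ ss)
advance-walk left w = left w
advance-walk up   w = up w
advance-walk diag w = diag w

walk-tail : ∀ {s x y x′ y′ j ss} → Advance s x y x′ y′ → Walk x y j (s ∷ ss) → Walk x′ y′ j ss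
walk-tail left (left w) = w
walk-tail up   (up w)   = w
walk-tail diag (diag w) = w

-- Implies that no other path of a valid family can visit the point (x , y).
Leading : ∀ {n} → State n → Fin n → ℕ → ℕ → Set
Leading st m x y = ∀ k → k ≢ m → st k ≡ absent ⊎ ∃₂ λ x′ y′ → st k ≡ at x′ y′ × (x′ < x ⊎ y < y′)

-- By `walk-bounds` a path now at `(x′ , y′)` stays weakly left of `x′` and weakly above `y′`;
-- either strict inequality in `Leading` excludes `(x , y)`.
leading-unvisited : ∀ {n} {st : State n} {m x y v} → Leading st m x y → Valid st v →
  ∀ k → k ≢ m → pt x y ∉ visits st v k
leading-unvisited {st = st} {v = v} lead V k k≢m p∈ with st k | lookup v k | V .fits k | lead k k≢m
leading-unvisited lead V k k≢m p∈ | _ | _ | enter _ | inj₁ ()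
leading-unvisited lead V k k≢m p∈ | _ | _ | enter _ | inj₂ (_ , _ , () , _)
leading-unvisited lead V k k≢m p∈ | _ | _ | at w | inj₂ (_ , _ , refl , ahead) with walk-bounds w p∈
leading-unvisited lead V k k≢m p∈ | _ | _ | at w | inj₂ (_ , _ , refl , inj₁ x′<x) | _ , _ , refl , x≤x′ , _ =
  ℕ.<⇒≱ x′<x x≤x′
leading-unvisited lead V k k≢m p∈ | _ | _ | at w | inj₂ (_ , _ , refl , inj₂ y<y′) | _ , _ , refl , _ , y′≤y =
  ℕ.<⇒≱ y<y′ y′≤y

StartsWith : Step → Maybe (List Step) → Set
StartsWith s c = ∃ λ ss → c ≡ just (s ∷ ss)

prepend : ∀ {n} → Fin n → Step → Family n → Family n
prepend m s v = updateAt v m (Maybe.map (s ∷_))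

prepend-injective : ∀ {n} (m : Fin n) s {v w} → prepend m s v ≡ prepend m s w → v ≡ w
prepend-injective m s {v} {w} e =
  trans (sym (tabulate∘lookup v)) (trans (tabulate-cong same) (tabulate∘lookup w))
  where
  same : ∀ i → lookup v i ≡ lookup w i
  same i with i ≟ m
  ... | yes refl = map-injective ∷-injectiveʳ
    (trans (sym (lookup∘updateAt m v)) (trans (cong (λ u → lookup u m) e) (lookup∘updateAt m w)))
  ... | no i≢m =
    trans (sym (lookup∘updateAt′ i m i≢m v)) (trans (cong (λ u → lookup u i) e) (lookup∘updateAt′ i m i≢m w))

-- Prepending `s` to path `m` is the bijection. Dropping the first vertex keeps paths disjoint;
-- restoring it does too, because no other path visits `(x , y)`.
count-branch : ∀ {n} (st : State n) m {s x y x′ y′ c} → st m ≡ at x y → Leading st m x y →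
  Advance s x y x′ y′ → Count (Valid (st [ m ↦ at x′ y′ ])) c →
  Count (λ v → Valid st v × StartsWith s (lookup v m)) c
count-branch {n} st m {s} {x} {y} {x′} {y′} st-m lead adv C =
  count-⇔ (λ { (w , refl , W) → extend W }) (λ (V , ss , v-m) → shorten V v-m)
    (count-image (prepend m s) (prepend-injective m s) C)
  where
  st′ = st [ m ↦ at x′ y′ ]

  visits-here : ∀ {st : State n} {v x y ss} → st m ≡ at x y → lookup v m ≡ just ss →
    visits st v m ≡ vertices (pt x y) ss
  visits-here e f = cong₂ (visited (toℕ m)) e f

  extend : ∀ {w} → Valid st′ w → Valid st (prepend m s w) × StartsWith s (lookup (prepend m s w) m)
  extend {w} W with lookup w m in w-m | subst (λ nd → Fits (toℕ m) nd (lookup w m)) ([↦]-here st m) (W .fits m)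
  ... | just ss | at walk = V , ss , v-m
    where
    v = prepend m s w
    v-m : lookup v m ≡ just (s ∷ ss)
    v-m = trans (lookup∘updateAt m w) (cong (Maybe.map (s ∷_)) w-m)
    others : ∀ i → i ≢ m → lookup v i ≡ lookup w i
    others i i≢m = lookup∘updateAt′ i m i≢m w
    -- `Leading` speaks only of indices other than `m`, so it passes from `st` to `st′` with the old
    -- point `(x , y)`.
    base : ∀ k → k ≢ m → pt x y ∉ visits st′ w k
    base k k≢m = leading-unvisited {st = st′} {m} {v = w}
      (λ k k≢m → subst (λ nd → nd ≡ absent ⊎ ∃₂ λ x′ y′ → nd ≡ at x′ y′ × (x′ < x ⊎ y < y′))
        (sym ([↦]-there st k k≢m)) (lead k k≢m)) W k k≢m
    V : Valid st v
    V = valid-transfer m (λ i i≢m → sym ([↦]-there st i i≢m)) others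
      (subst₂ (Fits (toℕ m)) (sym st-m) (sym v-m) (at (advance-walk adv walk))) disj W
      where
      disj : ∀ k → k ≢ m → Disjoint (visits st v m) (visits st′ w k)
      disj k k≢m {p} (∈m , ∈k) with subst (p ∈_) (visits-here {st} {v} st-m v-m) ∈m
      ... | here refl = base k k≢m ∈k
      ... | there p∈  = W .apart (k≢m ∘ sym)
        (subst (p ∈_) (sym (visits-here {st′} {w} ([↦]-here st m) w-m))
          (subst (λ q → p ∈ vertices q ss) (advance-move adv) p∈) , ∈k)

  shorten : ∀ {v ss} → Valid st v → lookup v m ≡ just (s ∷ ss) → ∃ λ w → v ≡ prepend m s w × Valid st′ w
  shorten {v} {ss} V v-m = w , sym restore , valid-transfer m ([↦]-there st) others
      (subst₂ (Fits (toℕ m)) (sym ([↦]-here st m)) (sym w-m) (at (walk-tail adv (walk (subst₂ (Fits (toℕ m)) st-m v-m (V .fits m)))))) disj V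
    where
    w = v [ m ]≔ just ss
    walk : ∀ {i x y ss} → Fits i (at x y) (just ss) → Walk x y (suc i) ss
    walk (at w) = w
    w-m : lookup w m ≡ just ss
    w-m = lookup∘updateAt m v
    others : ∀ i → i ≢ m → lookup w i ≡ lookup v i
    others i i≢m = lookup∘updateAt′ i m i≢m v
    restore : prepend m s w ≡ v
    restore = trans (updateAt-updateAt-local m {h = id} v (sym v-m)) (updateAt-id-local m v refl)
    disj : ∀ k → k ≢ m → Disjoint (visits st′ w m) (visits st v k)
    disj k k≢m {p} (∈m , ∈k) = V .apart (k≢m ∘ sym)
      (subst (p ∈_) (sym (visits-here {st} {v} st-m v-m))
        (there (subst (λ q → p ∈ vertices q ss) (sym (advance-move adv))
          (subst (p ∈_) (visits-here {st′} {w} ([↦]-here st m) w-m) ∈m))) , ∈k)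

counted-advance : ∀ {n} (st : State n) m {x y} → st m ≡ at (suc x) y → Leading st m (suc x) y →
  (∀ {s x′ y′} → Advance s (suc x) y x′ y′ → Counted (st [ m ↦ at x′ y′ ])) → Counted st
counted-advance {n} st m {x} {y} st-m lead next
  with next up | next left | next diag
... | a , A , detA | b , B , detB | c , C , detC = a ℕ+ (b ℕ+ c) ,
  count-⇔ (λ { (inj₁ (V , _)) → V ; (inj₂ (inj₁ (V , _))) → V ; (inj₂ (inj₂ (V , _))) → V }) first-step
    (count-⊎ (λ { (_ , U₁) (inj₁ (_ , L₁)) → differ (λ ()) U₁ L₁ ; (_ , U₁) (inj₂ (_ , D₁)) → differ (λ ()) U₁ D₁ })
      (count-branch st m st-m lead up A)
      (count-⊎ (λ (_ , L₁) (_ , D₁) → differ (λ ()) L₁ D₁)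
        (count-branch st m st-m lead left B) (count-branch st m st-m lead diag C))) ,
  det-sum
  where
  differ : ∀ {s t c} → s ≢ t → StartsWith s c → ¬ StartsWith t c
  differ s≢t (_ , refl) (_ , e) = s≢t (∷-injectiveˡ (just-injective e))
  first-step : ∀ {v} → Valid st v → (Valid st v × StartsWith U (lookup v m)) ⊎
    ((Valid st v × StartsWith L (lookup v m)) ⊎ (Valid st v × StartsWith D (lookup v m)))
  first-step {v} V with lookup v m | subst (λ nd → Fits (toℕ m) nd (lookup v m)) st-m (V .fits m)
  ... | _ | at (up _)   = inj₁ (V , _ , refl)
  ... | _ | at (left _) = inj₂ (inj₁ (V , _ , refl))
  ... | _ | at (diag _) = inj₂ (inj₂ (V , _ , refl))
  -- Additivity is applied twice: first the up step is split off, then the left and diagonal steps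
  -- are separated. The intermediate matrix has the sum of the latter two as row `m` and need not
  -- come from a state.
  rest : Matrix n
  rest = F.updateAt (rows st) m λ _ j → row m (at x y) j + row m (at x (suc y)) j
  off : ∀ {nd} i → i ≢ m → ∀ j → rest i j ≡ rows (st [ m ↦ nd ]) i j
  off i i≢m j = trans (cong (λ r → r j) (F.updateAt-minimal i m (rows st) i≢m))
    (cong (λ nd → row i nd j) (sym ([↦]-there st i i≢m)))
  here-row : ∀ {nd} j → rows (st [ m ↦ nd ]) m j ≡ row m nd j
  here-row j = cong (λ nd → row m nd j) ([↦]-here st m)
  rest-m : ∀ j → rest m j ≡ row m (at x y) j + row m (at x (suc y)) j
  rest-m j = cong (λ r → r j) (F.updateAt-updates m (rows st))
  det-sum : + (a ℕ+ (b ℕ+ c)) ≡ det n (rows st)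
  det-sum = trans (pos-+ a (b ℕ+ c)) (trans (cong₂ _+_ detA (trans (pos-+ b c) (trans (cong₂ _+_ detB detC)
      (sym (det-row-+ m (λ j → trans (rest-m j) (sym (cong₂ _+_ (here-row j) (here-row j)))) off off)))))
    (sym (det-row-+ m
      (λ j → trans (cong (λ nd → row m nd j) st-m) (trans
        (trans (cong +_ (paths-step x y (suc (toℕ j)))) (trans (pos-+ (paths (suc x) (suc y) (suc (toℕ j))) _)
          (cong (_+_ (+ paths (suc x) (suc y) (suc (toℕ j)))) (pos-+ (paths x y (suc (toℕ j))) _))))
        (sym (cong₂ _+_ (here-row j) (rest-m j)))))
      (λ i i≢m j → cong (λ nd → row i nd j) (sym ([↦]-there st i i≢m)))
      (λ i i≢m j → cong (λ r → r j) (sym (F.updateAt-minimal i m (rows st) i≢m))))))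

-- Ordered states, collisions and overshoots

at-injective : ∀ {x y x′ y′} → at x y ≡ at x′ y′ → x ≡ x′ × y ≡ y′
at-injective refl = refl , refl

Decided : ∀ {n} → State n → Set
Decided st = ∀ i → st i ≢ undecided

-- The inequalities are weak, so that a step onto another current point preserves them; the
-- collision is then detected in the next round.
Ordered : ∀ {n} → State n → Set
Ordered st = ∀ {i k x y x′ y′} → toℕ i < toℕ k → st i ≡ at x y → st k ≡ at x′ y′ → x ≤ x′ × y ≤ y′

Collision : ∀ {n} → State n → Set
Collision {n} st = ∃₂ λ (i k : Fin n) → i ≢ k × ∃₂ λ x y → st i ≡ at x y × st k ≡ at x y

collision? : ∀ {n} (st : State n) → Dec (Collision st)
collision? st = any? λ i → any? λ k → ¬? (i ≟ k) ×-dec same? (st i) (st k)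
  where
  same? : ∀ a b → Dec (∃₂ λ x y → a ≡ at x y × b ≡ at x y)
  same? (at x y) (at x′ y′) = map′ (λ { (refl , refl) → x , y , refl , refl })
    (λ { (_ , _ , refl , refl) → refl , refl }) (x ℕ.≟ x′ ×-dec y ℕ.≟ y′)
  same? (at _ _)  undecided = no λ { (_ , _ , _ , ()) }
  same? (at _ _)  absent    = no λ { (_ , _ , _ , ()) }
  same? undecided _         = no λ { (_ , _ , () , _) }
  same? absent    _         = no λ { (_ , _ , () , _) }

-- The highest end point has height `n`. Excluding greater heights also bounds the number of up
-- steps, which termination relies on.
TooHigh : ∀ {n} → State n → Set
TooHigh {n} st = ∃ λ (i : Fin n) → ∃₂ λ x y → st i ≡ at x y × n < y

tooHigh? : ∀ {n} (st : State n) → Dec (TooHigh st)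
tooHigh? {n} st = any? λ i → high? (st i)
  where
  high? : ∀ a → Dec (∃₂ λ x y → a ≡ at x y × n < y)
  high? (at x y)  = map′ (λ n<y → x , y , refl , n<y) (λ { (_ , _ , refl , n<y) → n<y }) (n ℕ.<? y)
  high? undecided = no λ { (_ , _ , () , _) }
  high? absent    = no λ { (_ , _ , () , _) }

valid-walk : ∀ {n} {st : State n} {v i x y} → Valid st v → st i ≡ at x y →
  ∃ λ ss → lookup v i ≡ just ss × Walk x y (suc (toℕ i)) ss
valid-walk {v = v} {i} V e with lookup v i | subst (λ nd → Fits (toℕ i) nd (lookup v i)) e (V .fits i)
... | just ss | at w = ss , refl , w

source∈visits : ∀ {n} {st : State n} {v i x y} → Valid st v → st i ≡ at x y → pt x y ∈ visits st v i
source∈visits {st = st} {v} {i} {x} {y} V e with valid-walk {st = st} {v} {i} V e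
... | ss , v-i , _ = subst (pt x y ∈_) (sym (cong₂ (visited (toℕ i)) e v-i)) (first ss)
  where
  first : ∀ {p} ss → p ∈ vertices p ss
  first []      = here refl
  first (_ ∷ _) = here refl

-- The row of `at x y` does not depend on the index, so the two rows agree, while any family would
-- visit the common point twice.
counted-collision : ∀ {n} (st : State n) → Collision st → Counted st
counted-collision st (i , k , i≢k , x , y , st-i , st-k) = 0 ,
  count-none (λ V → V .apart i≢k (source∈visits V st-i , source∈visits V st-k)) ,
  sym (det-equal-rows (rows st) i k i≢k λ j →
    trans (cong (λ nd → row i nd j) st-i) (sym (cong (λ nd → row k nd j) st-k)))

counted-tooHigh : ∀ {n} (st : State n) → TooHigh st → Counted st
counted-tooHigh st (i , x , y , st-i , n<y) = 0 ,
  count-none (λ {v} V → let _ , _ , w = valid-walk {st = st} {v} V st-i in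
    ℕ.<⇒≱ n<y (ℕ.≤-trans (walk-≤ w) (toℕ<n i))) ,
  sym (det-zero-row i λ j → trans (cong (λ nd → row i nd j) st-i)
    (cong +_ (paths-above x (ℕ.≤-<-trans (toℕ<n j) n<y))))

-- States with all paths on the axis

identity-paths : ∀ {n} (i j : Fin n) → identity n i j ≡ + paths 0 (toℕ i) (toℕ j)
identity-paths i j with i ≟ j
... | yes refl = cong +_ (sym (paths-end (toℕ i)))
... | no i≢j   = cong +_ (sym (paths-off (i≢j ∘ toℕ-injective)))

-- For either node the entry of a family is forced, and the row is row `i` of the identity, by
-- `identity-paths` in the second case.
data Home {n} (i : Fin n) : Node → Set where
  absent : Home i absent
  at     : Home i (at 0 (suc (toℕ i)))

module _ {n} (st : State n) (home : ∀ i → Home i (st i)) where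

  stay : Node → Maybe (List Step)
  stay (at _ _) = just []
  stay _        = nothing

  stay-family : Family n
  stay-family = tabulate (stay ∘ st)

  stay-valid : Valid st stay-family
  stay-valid = record { fits = stay-fits ; apart = stay-apart }
    where
    stay-fits : ∀ i → Fits (toℕ i) (st i) (lookup stay-family i)
    stay-fits i rewrite lookup∘tabulate (stay ∘ st) i with st i | home i
    ... | _ | absent = absent
    ... | _ | at     = at done
    only : ∀ {i nd p} → Home {n} i nd → p ∈ visited (toℕ i) nd (stay nd) → p ≡ pt 0 (suc (toℕ i))
    only at (here e) = e
    at-end : ∀ {i p} → p ∈ visits st stay-family i → p ≡ pt 0 (suc (toℕ i))
    at-end {i} {p} p∈ = only (home i) (subst (λ c → p ∈ visited (toℕ i) (st i) c) (lookup∘tabulate (stay ∘ st) i) p∈)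
    stay-apart : ∀ {i k} → i ≢ k → Disjoint (visits st stay-family i) (visits st stay-family k)
    stay-apart i≢k (∈i , ∈k) = i≢k (toℕ-injective (ℕ.suc-injective
      (proj₂ (pt-injective (trans (sym (at-end ∈i)) (at-end ∈k))))))

  stay-only : ∀ {v} → Valid st v → v ≡ stay-family
  stay-only {v} V = trans (sym (tabulate∘lookup v)) (tabulate-cong λ i → forced (home i) (V .fits i))
    where
    forced : ∀ {i nd c} → Home {n} i nd → Fits (toℕ i) nd c → c ≡ stay nd
    forced absent absent    = refl
    forced at     (at done) = refl

  counted-home : Counted st
  counted-home = 1 , count-one stay-family stay-valid stay-only ,
    sym (trans (det-cong λ i j → home-row (home i) j) (det-identity n))
    where
    home-row : ∀ {i nd} → Home i nd → ∀ j → row i nd j ≡ identity n i j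
    home-row absent j = refl
    home-row {i} at j = sym (identity-paths i j)

allHome? : ∀ {n} (i : Fin n) nd → Dec (Home i nd)
allHome? i undecided = no λ ()
allHome? i absent    = yes absent
allHome? i (at (suc x) y) = no λ ()
allHome? i (at 0 y) with y ℕ.≟ suc (toℕ i)
... | yes refl = yes at
... | no y≢    = no λ { at → y≢ refl }

OnAxis : ∀ {n} → State n → Set
OnAxis st = ∀ i → st i ≡ absent ⊎ ∃ λ y → st i ≡ at 0 y

module _ {n} (st : State n) (axis : OnAxis st) (ordered : Ordered st)
         (free : ¬ Collision st) (low : ¬ TooHigh st) where

  heights-< : ∀ {i k y y′} → toℕ i < toℕ k → st i ≡ at 0 y → st k ≡ at 0 y′ → y < y′
  heights-< i<k st-i st-k = ℕ.≤∧≢⇒< (proj₂ (ordered i<k st-i st-k))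
    λ { refl → free (_ , _ , (λ { refl → ℕ.<-irrefl refl i<k }) , _ , _ , st-i , st-k) }

  target : ∀ i {y} → st i ≡ at 0 (suc y) → ∃ λ (k : Fin n) → y ≡ toℕ k
  target i st-i = fromℕ< y<n , sym (toℕ-fromℕ< y<n)
    where
    y<n = ℕ.≮⇒≥ λ n<y → low (i , _ , _ , st-i , n<y)

  det-bottom : ∀ i → st i ≡ at 0 0 → det n (rows st) ≡ + 0
  det-bottom i st-i = det-zero-row i λ j → cong (λ nd → row i nd j) st-i

  -- A path at the end point of `k` contributes row `k` of the identity, and so does the absent path
  -- `k`: two equal rows.
  det-absent : ∀ (i k : Fin n) → st i ≡ at 0 (suc (toℕ k)) → st k ≡ absent → det n (rows st) ≡ + 0
  det-absent i k st-i st-k = det-equal-rows (rows st) i k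
    (λ { refl → contradiction (trans (sym st-i) st-k) λ () })
    λ j → trans (cong (λ nd → row i nd j) st-i)
      (trans (sym (identity-paths k j)) (sym (cong (λ nd → row k nd j) st-k)))

  -- Heights increase strictly with the index, so path `k`, if present, lies above its own end point
  -- as well. Following the occupied end points climbs through the indices until an absent one is
  -- met; `d` bounds the indices left.
  det-above : ∀ d (i k : Fin n) → n ≤ toℕ i ℕ+ d → st i ≡ at 0 (suc (toℕ k)) → toℕ i < toℕ k → det n (rows st) ≡ + 0
  det-above zero i k n≤ st-i i<k = contradiction (toℕ<n i) (ℕ.≤⇒≯ (subst (n ≤_) (ℕ.+-identityʳ _) n≤))
  det-above (suc d) i k n≤ st-i i<k with axis k
  ... | inj₁ st-k = det-absent i k st-i st-k
  ... | inj₂ (zero , st-k) = det-bottom k st-k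
  ... | inj₂ (suc y , st-k) with target k st-k
  ... | k′ , refl = det-above d k k′
        (ℕ.≤-trans n≤ (ℕ.≤-trans (ℕ.≤-reflexive (ℕ.+-suc (toℕ i) d)) (ℕ.+-monoˡ-≤ d i<k)))
        st-k (ℕ.≤-pred (heights-< i<k st-i st-k))

  -- The mirror image of `det-above`: the chain descends, and ends at an absent index or at a path
  -- of height 0, whose row is zero.
  det-below : ∀ d (i k : Fin n) → toℕ i < d → st i ≡ at 0 (suc (toℕ k)) → toℕ k < toℕ i → det n (rows st) ≡ + 0
  det-below (suc d) i k i<d st-i k<i with axis k
  ... | inj₁ st-k = det-absent i k st-i st-k
  ... | inj₂ (zero , st-k) = det-bottom k st-k
  ... | inj₂ (suc y , st-k) with target k st-k
  ... | k′ , refl = det-below d k k′ (ℕ.<-≤-trans k<i (ℕ.≤-pred i<d))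
        st-k (ℕ.≤-pred (heights-< k<i st-k st-i))

  det-not-home : ∀ i → ¬ Home i (st i) → det n (rows st) ≡ + 0
  det-not-home i away with axis i
  ... | inj₁ st-i = contradiction (subst (Home i) (sym st-i) absent) away
  ... | inj₂ (zero , st-i) = det-bottom i st-i
  ... | inj₂ (suc y , st-i) with target i st-i
  ... | k , refl with ℕ.<-cmp (toℕ i) (toℕ k)
  ... | tri< i<k _ _ = det-above n i k (ℕ.m≤n+m n (toℕ i)) st-i i<k
  ... | tri≈ _ i≡k _ =
    contradiction (subst (Home i) (sym (trans st-i (cong (λ y → at 0 (suc y)) (sym i≡k)))) at) away
  ... | tri> _ _ k<i = det-below (suc (toℕ i)) i k ℕ.≤-refl st-i k<i

  counted-axis : Counted st
  counted-axis with all? (λ i → allHome? i (st i))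
  ... | yes home = counted-home st home
  ... | no ¬home with ¬∀⟶∃¬ n _ (λ i → allHome? i (st i)) ¬home
  ... | i , away = 0 , count-none none , sym (det-not-home i away)
    where
    none : ∀ {v} → ¬ Valid st v
    none {v} V = away (arrived (axis i) (V .fits i))
      where
      arrived : ∀ {i nd c} → nd ≡ absent ⊎ (∃ λ y → nd ≡ at 0 y) → Fits (toℕ {n} i) nd c → Home i nd
      -- On the axis a walk can only be `done`, which puts the path at its own end point.
      arrived (inj₁ refl) absent = absent
      arrived (inj₂ (_ , refl)) (at done) = at

-- Choice of the leading path and recursion over decided states

leftmost-max : ∀ {n} (g : Fin n → ℕ) → (∀ i → g i ≡ 0) ⊎
  ∃ λ m → 0 < g m × (∀ i → toℕ i < toℕ m → g i < g m) × (∀ k → g k ≤ g m)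
leftmost-max {zero}  g = inj₁ λ ()
leftmost-max {suc n} g with g zero in g0 | leftmost-max (g ∘ suc)
... | zero  | inj₁ z = inj₁ λ { zero → g0 ; (suc i) → z i }
... | suc a | inj₁ z = inj₂ (zero , subst (0 <_) (sym g0) z<s , (λ _ ()) ,
  λ { zero → ℕ.≤-refl ; (suc k) → subst (_≤ g zero) (sym (z k)) z≤n })
... | a     | inj₂ (m , pos , before , max) with g (suc m) ℕ.≤? g zero
... | yes m≤0 = inj₂ (zero , ℕ.<-≤-trans pos m≤0 , (λ _ ()) ,
  λ { zero → ℕ.≤-refl ; (suc k) → ℕ.≤-trans (max k) m≤0 })
... | no m≰0 = inj₂ (suc m , pos , (λ { zero _ → ℕ.≰⇒> m≰0 ; (suc i) i<m → before i (ℕ.≤-pred i<m) }) ,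
  λ { zero → ℕ.<⇒≤ (ℕ.≰⇒> m≰0) ; (suc k) → max k })

sumℕ : ∀ {n} → (Fin n → ℕ) → ℕ
sumℕ {zero}  f = 0
sumℕ {suc n} f = f zero ℕ+ sumℕ (f ∘ suc)

sumℕ-cong : ∀ {n} {f g : Fin n → ℕ} → (∀ i → f i ≡ g i) → sumℕ f ≡ sumℕ g
sumℕ-cong {zero}  e = refl
sumℕ-cong {suc n} e = cong₂ _ℕ+_ (e zero) (sumℕ-cong (e ∘ suc))

sumℕ-< : ∀ {n} {f g : Fin n → ℕ} m → f m < g m → (∀ i → i ≢ m → f i ≡ g i) → sumℕ f < sumℕ g
sumℕ-< zero    f<g e = ℕ.+-mono-<-≤ f<g (ℕ.≤-reflexive (sumℕ-cong λ i → e (suc i) λ ()))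
sumℕ-< (suc m) f<g e = ℕ.+-mono-≤-< (ℕ.≤-reflexive (e zero λ ()))
  (sumℕ-< m f<g λ i i≢m → e (suc i) λ { refl → i≢m refl })

-- The default 0 ensures that a positive maximum is attained by a path still off the axis.
abscissa : Node → ℕ
abscissa (at x y) = x
abscissa _        = 0

-- Remaining room to the left plus room above. With `suc h` in place of `h`, an up step from height
-- `h` still lowers the weight.
weight : ℕ → Node → ℕ
weight h (at x y) = x ℕ+ (suc h ∸ y)
weight h _        = 0

advance-weight : ∀ {h s x y x′ y′} → Advance s x y x′ y′ → y ≤ h → weight h (at x′ y′) < weight h (at x y)
advance-weight left y≤h = ℕ.≤-refl
advance-weight {h} {x = suc x} {y} up y≤h = ℕ.+-monoʳ-< (suc x) (ℕ.≤-reflexive (sym (ℕ.+-∸-assoc 1 y≤h)))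
advance-weight {h} {x = suc x} {y} diag y≤h =
  s≤s (ℕ.+-monoʳ-≤ x (ℕ.∸-monoˡ-≤ y (ℕ.n≤1+n h)))

advance-bounds : ∀ {s x y x′ y′} → Advance s (suc x) y x′ y′ → (x ≤ x′ × x′ ≤ suc x) × (y ≤ y′ × y′ ≤ suc y)
advance-bounds left = (ℕ.≤-refl , ℕ.n≤1+n _) , (ℕ.≤-refl , ℕ.n≤1+n _)
advance-bounds up   = (ℕ.n≤1+n _ , ℕ.≤-refl) , (ℕ.n≤1+n _ , ℕ.≤-refl)
advance-bounds diag = (ℕ.≤-refl , ℕ.n≤1+n _) , (ℕ.n≤1+n _ , ℕ.≤-refl)

-- Each advance lowers the total weight, which `fuel` bounds. Excluding collisions first supplies
-- the strict inequalities behind `Leading`; excluding overshoots makes the weight drop.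
counted-decided : ∀ {n} fuel (st : State n) → sumℕ (weight n ∘ st) < fuel → Decided st → Ordered st → Counted st
counted-decided {n} (suc fuel) st w<fuel decided ordered with collision? st | tooHigh? st | leftmost-max (abscissa ∘ st)
... | yes c | _ | _ = counted-collision st c
... | no _  | yes h | _ = counted-tooHigh st h
... | no free | no low | inj₁ z = counted-axis st axis ordered free low
  where
  axis : OnAxis st
  axis i with st i | z i | decided i
  ... | undecided | _    | d = ⊥-elim (d refl)
  ... | absent    | _    | _ = inj₁ refl
  ... | at 0 y    | refl | _ = inj₂ (y , refl)
... | no free | no low | inj₂ (m , pos , before , max) = proceed (located (st m) refl)
  where
  located : ∀ nd → st m ≡ nd → ∃₂ λ x y → st m ≡ at (suc x) y
  located (at (suc x) y) e = x , y , e
  located (at 0 y)  e = contradiction (subst (λ nd → 0 < abscissa nd) e pos) λ ()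
  located absent    e = contradiction (subst (λ nd → 0 < abscissa nd) e pos) λ ()
  located undecided e = contradiction (subst (λ nd → 0 < abscissa nd) e pos) λ ()

  proceed : (∃₂ λ x y → st m ≡ at (suc x) y) → Counted st
  proceed (x , y , st-m) = counted-advance st m st-m leading next
    where
    -- Ties for the greatest abscissa go to the smallest index, so every path of smaller index is
    -- strictly further left.
    inner : ∀ {i x′ y′} → toℕ i < toℕ m → st i ≡ at x′ y′ → x′ ≤ x
    inner i<m st-i = ℕ.≤-pred (subst₂ (λ a b → abscissa a < abscissa b) st-i st-m (before _ i<m))
    -- By order and maximality path `k` has the same abscissa as path `m`; an equal height would be
    -- a collision.
    outer : ∀ {k x′ y′} → toℕ m < toℕ k → st k ≡ at x′ y′ → y < y′
    outer {k} m<k st-k with ordered m<k st-m st-k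
    ... | x≤ , y≤ = ℕ.≤∧≢⇒< y≤ λ { refl → free (m , k , (λ { refl → ℕ.<-irrefl refl m<k }) , suc x , y , st-m ,
      trans st-k (cong (λ a → at a y) (ℕ.≤-antisym (subst₂ (λ a b → abscissa a ≤ abscissa b) st-k st-m (max k)) x≤))) }

    leading : Leading st m (suc x) y
    leading k k≢m with st k in st-k
    ... | undecided = contradiction st-k (decided k)
    ... | absent    = inj₁ refl
    ... | at x′ y′ with ℕ.<-cmp (toℕ k) (toℕ m)
    ... | tri< k<m _ _ = inj₂ (x′ , y′ , refl , inj₁ (s≤s (inner k<m st-k)))
    ... | tri≈ _ k≡m _ = contradiction (toℕ-injective k≡m) k≢m
    ... | tri> _ _ m<k = inj₂ (x′ , y′ , refl , inj₂ (outer m<k st-k))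

    next : ∀ {s x′ y′} → Advance s (suc x) y x′ y′ → Counted (st [ m ↦ at x′ y′ ])
    next {s} {x′} {y′} adv = counted-decided fuel st′ (ℕ.<-≤-trans lighter (ℕ.≤-pred w<fuel)) decided′ ordered′
      where
      st′ : State n
      st′ = st [ m ↦ at x′ y′ ]
      lighter : sumℕ (weight n ∘ st′) < sumℕ (weight n ∘ st)
      lighter = sumℕ-< m
        (subst₂ (λ a b → weight n a < weight n b) (sym ([↦]-here st m)) (sym st-m)
          (advance-weight adv (ℕ.≮⇒≥ λ n<y → low (m , suc x , y , st-m , n<y))))
        λ i i≢m → cong (weight n) ([↦]-there st i i≢m)
      decided′ : Decided st′
      decided′ i with i ≟ m
      ... | yes refl = λ e → contradiction (trans (sym ([↦]-here st m)) e) λ ()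
      ... | no i≢m   = decided i ∘ trans (sym ([↦]-there st i i≢m))
      -- A step changes each coordinate by at most one: the strictness in `outer` absorbs a rise
      -- against larger indices, that in `inner` a move left against smaller ones.
      ordered′ : Ordered st′
      ordered′ {i} {k} i<k st-i st-k with i ≟ m | k ≟ m | advance-bounds adv
      ... | yes refl | yes refl | _ = contradiction i<k (ℕ.<-irrefl refl)
      ... | no i≢m | no k≢m | _ =
        ordered i<k (trans (sym ([↦]-there st i i≢m)) st-i) (trans (sym ([↦]-there st k k≢m)) st-k)
      ... | yes refl | no k≢m | (_ , x′≤) , (_ , y′≤) with at-injective (trans (sym ([↦]-here st m)) st-i)
      ... | refl , refl = ℕ.≤-trans x′≤ (proj₁ (ordered i<k st-m st-k′)) , ℕ.≤-trans y′≤ (outer i<k st-k′)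
        where st-k′ = trans (sym ([↦]-there st k k≢m)) st-k
      ordered′ {i} {k} i<k st-i st-k | no i≢m | yes refl | (≤x′ , _) , (≤y′ , _) with at-injective (trans (sym ([↦]-here st m)) st-k)
      ... | refl , refl = ℕ.≤-trans (inner i<k st-i′) ≤x′ , ℕ.≤-trans (proj₂ (ordered i<k st-i′ st-m)) ≤y′
        where st-i′ = trans (sym ([↦]-there st i i≢m)) st-i

-- Deciding which paths are present

Initial : ∀ {n} → Fin n → Node → Set
Initial i nd = nd ≡ undecided ⊎ (nd ≡ absent ⊎ nd ≡ at (toℕ i) 0)

-- Indices from `k` on are settled already, and the induction decides the largest open one. At
-- `k = 0` all present paths stand at their starting points, which are ordered.
counted-initial : ∀ {n} k → k ≤ n → (st : State n) → (∀ i → Initial i (st i)) →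
  (∀ i → k ≤ toℕ i → st i ≢ undecided) → Counted st
counted-initial zero k≤n st init decided =
  counted-decided _ st ℕ.≤-refl (λ i → decided i z≤n) λ i<k st-i st-k → ordered (init _) (init _) i<k st-i st-k
  where
  ordered : ∀ {n} {i k : Fin n} {a b x y x′ y′} → Initial i a → Initial k b → toℕ i < toℕ k →
    a ≡ at x y → b ≡ at x′ y′ → x ≤ x′ × y ≤ y′
  ordered (inj₂ (inj₂ refl)) (inj₂ (inj₂ refl)) i<k refl refl = ℕ.<⇒≤ i<k , z≤n
  ordered (inj₁ refl) _ _ () _
  ordered (inj₂ (inj₁ refl)) _ _ () _
  ordered _ (inj₁ refl) _ _ ()
  ordered _ (inj₂ (inj₁ refl)) _ _ ()
counted-initial {n} (suc k) k<n st init decided = cases (st m) refl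
  where
  m : Fin n
  m = fromℕ< k<n
  later : ∀ i → i ≢ m → k ≤ toℕ i → st i ≢ undecided
  later i i≢m k≤i = decided i (ℕ.≤∧≢⇒< k≤i λ { refl → i≢m (toℕ-injective (sym (toℕ-fromℕ< k<n))) })
  settle : st m ≢ undecided → Counted st
  settle st-m≢ = counted-initial k (ℕ.<⇒≤ k<n) st init decided′
    where
    decided′ : ∀ i → k ≤ toℕ i → st i ≢ undecided
    decided′ i with i ≟ m
    ... | yes refl = λ _ → st-m≢
    ... | no i≢m   = later i i≢m
  branch : ∀ {nd} → nd ≡ absent ⊎ nd ≡ at (toℕ m) 0 → nd ≢ undecided → Counted (st [ m ↦ nd ])
  branch {nd} shape nd≢ = counted-initial k (ℕ.<⇒≤ k<n) (st [ m ↦ nd ]) init′ decided′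
    where
    init′ : ∀ i → Initial i ((st [ m ↦ nd ]) i)
    init′ i with i ≟ m
    ... | yes refl = inj₂ (subst (λ a → a ≡ absent ⊎ a ≡ at (toℕ m) 0) (sym ([↦]-here st m)) shape)
    ... | no i≢m   = subst (Initial i) (sym ([↦]-there st i i≢m)) (init i)
    decided′ : ∀ i → k ≤ toℕ i → (st [ m ↦ nd ]) i ≢ undecided
    decided′ i k≤i with i ≟ m
    ... | yes refl = nd≢ ∘ trans (sym ([↦]-here st m))
    ... | no i≢m   = later i i≢m k≤i ∘ trans (sym ([↦]-there st i i≢m))
  cases : ∀ nd → st m ≡ nd → Counted st
  cases undecided st-m = counted-undecided st m st-m (branch (inj₁ refl) λ ()) (branch (inj₂ refl) λ ())
  cases absent    st-m = settle λ e → contradiction (trans (sym st-m) e) λ ()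
  cases (at _ _)  st-m = settle λ e → contradiction (trans (sym st-m) e) λ ()

counted-all-undecided : ∀ n → Counted {n} (const undecided)
counted-all-undecided n = counted-initial n ℕ.≤-refl (const undecided) (λ _ → inj₁ refl)
  λ i n≤i → contradiction (toℕ<n i) (ℕ.≤⇒≯ n≤i)

-- Comparison with the families of the statement

disjoint⇒noCommonVertex : ∀ {xs ys} → Disjoint xs ys → NoCommonVertex xs ys
disjoint⇒noCommonVertex d =
  All.tabulate λ x∈ → All.tabulate λ y∈ → fromWitnessFalse λ { refl → d (x∈ , y∈) }

noCommonVertex⇒disjoint : ∀ {xs ys} → NoCommonVertex xs ys → Disjoint xs ys
noCommonVertex⇒disjoint nc (x∈ , y∈) = toWitnessFalse (All.lookup (All.lookup nc x∈) y∈) refl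

-- Membership in `presentFrom m v` in terms of positions; the offset `m` follows the recursion of
-- `presentFrom`.
At : ∀ {n} → ℕ → Family n → ℕ × List Step → Set
At {n} m v (k , ss) = ∃ λ (i : Fin n) → k ≡ m ℕ+ toℕ i × lookup v i ≡ just ss

at-suc : ∀ {n m c} {v : Family n} {p} → At (suc m) v p → At m (c ∷ v) p
at-suc {m = m} (i , e , f) = suc i , trans e (sym (ℕ.+-suc m (toℕ i))) , f

at-≤ : ∀ {n m} {v : Family n} {p} → At m v p → m ≤ proj₁ p
at-≤ {m = m} (i , refl , _) = ℕ.m≤m+n m (toℕ i)

all-present⁺ : ∀ {n} {Q : ℕ × List Step → Set} m (v : Family n) →
  (∀ {p} → At m v p → Q p) → All Q (presentFrom m v)
all-present⁺ m []            q = []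
all-present⁺ m (nothing ∷ v) q = all-present⁺ (suc m) v (q ∘ at-suc)
all-present⁺ m (just ss ∷ v) q = q (zero , sym (ℕ.+-identityʳ m) , refl) ∷ all-present⁺ (suc m) v (q ∘ at-suc)

all-present⁻ : ∀ {n} {Q : ℕ × List Step → Set} m (v : Family n) →
  All Q (presentFrom m v) → ∀ {i ss} → lookup v i ≡ just ss → Q (m ℕ+ toℕ i , ss)
all-present⁻ {Q = Q} m (nothing ∷ v) qs {suc i} {ss} e =
  subst (λ k → Q (k , ss)) (sym (ℕ.+-suc m (toℕ i))) (all-present⁻ (suc m) v qs e)
all-present⁻ {Q = Q} m (just ss ∷ v) (q ∷ qs) {zero} refl = subst (λ k → Q (k , ss)) (sym (ℕ.+-identityʳ m)) q
all-present⁻ {Q = Q} m (just _ ∷ v)  (_ ∷ qs) {suc i} {ss} e =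
  subst (λ k → Q (k , ss)) (sym (ℕ.+-suc m (toℕ i))) (all-present⁻ (suc m) v qs e)

pairs-present⁺ : ∀ {n} {R : ℕ × List Step → ℕ × List Step → Set} m (v : Family n) →
  (∀ {p q} → proj₁ p < proj₁ q → At m v p → At m v q → R p q) → AllPairs R (presentFrom m v)
pairs-present⁺ m []            r = []
pairs-present⁺ m (nothing ∷ v) r = pairs-present⁺ (suc m) v λ p<q p q → r p<q (at-suc p) (at-suc q)
pairs-present⁺ m (just ss ∷ v) r =
  all-present⁺ (suc m) v (λ q → r (at-≤ {v = v} q) (zero , sym (ℕ.+-identityʳ m) , refl) (at-suc q)) ∷
  pairs-present⁺ (suc m) v λ p<q p q → r p<q (at-suc p) (at-suc q)

pairs-present⁻ : ∀ {n} {R : ℕ × List Step → ℕ × List Step → Set} m (v : Family n) →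
  AllPairs R (presentFrom m v) → ∀ {i k ss ss′} → toℕ i < toℕ k → lookup v i ≡ just ss → lookup v k ≡ just ss′ →
  R (m ℕ+ toℕ i , ss) (m ℕ+ toℕ k , ss′)
pairs-present⁻ {R = R} m (nothing ∷ v) rs {suc i} {suc k} {ss} {ss′} i<k e f =
  subst₂ (λ a b → R (a , ss) (b , ss′)) (sym (ℕ.+-suc m (toℕ i))) (sym (ℕ.+-suc m (toℕ k)))
    (pairs-present⁻ (suc m) v rs (s<s⁻¹ i<k) e f)
pairs-present⁻ {R = R} m (just _ ∷ v) (r ∷ _) {zero} {suc k} {ss} {ss′} i<k refl f =
  subst₂ (λ a b → R (a , ss) (b , ss′)) (sym (ℕ.+-identityʳ m)) (sym (ℕ.+-suc m (toℕ k)))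
    (all-present⁻ (suc m) v r f)
pairs-present⁻ {R = R} m (just _ ∷ v) (_ ∷ rs) {suc i} {suc k} {ss} {ss′} i<k e f =
  subst₂ (λ a b → R (a , ss) (b , ss′)) (sym (ℕ.+-suc m (toℕ i))) (sym (ℕ.+-suc m (toℕ k)))
    (pairs-present⁻ (suc m) v rs (s<s⁻¹ i<k) e f)

valid⇒validFamily : ∀ {n} {v : Family n} → Valid (const undecided) v → ValidFamily v
valid⇒validFamily {v = v} V =
  all-present⁺ 0 v (λ { (i , refl , e) → path (V .fits i) e }) ,
  pairs-present⁺ 0 v λ { i<k (i , refl , e) (k , refl , f) → disjoint⇒noCommonVertex
    (subst₂ (λ c d → Disjoint (visited (toℕ i) undecided c) (visited (toℕ k) undecided d)) e f
      (V .apart λ { refl → ℕ.<-irrefl refl i<k })) }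
  where
  path : ∀ {i c ss} → Fits i undecided c → c ≡ just ss → ValidPath (i , ss)
  path (enter w) refl = walk⇒rpath w

validFamily⇒valid : ∀ {n} {v : Family n} → ValidFamily v → Valid (const undecided) v
validFamily⇒valid {n} {v} (paths-ok , pairs-ok) = record { fits = fits′ ; apart = apart′ }
  where
  fits′ : ∀ i → Fits (toℕ i) undecided (lookup v i)
  fits′ i with lookup v i in e
  ... | nothing = leave
  ... | just ss = enter (rpath⇒walk (all-present⁻ 0 v paths-ok e))
  below : ∀ {i k} → toℕ i < toℕ k → Disjoint (visits (const undecided) v i) (visits (const undecided) v k)
  below {i} {k} i<k with lookup v i in e | lookup v k in f
  ... | nothing | _       = λ { (() , _) }
  ... | just _  | nothing = λ { (_ , ()) }
  ... | just _  | just _  = noCommonVertex⇒disjoint (pairs-present⁻ 0 v pairs-ok i<k e f)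
  apart′ : ∀ {i k} → i ≢ k → Disjoint (visits (const undecided) v i) (visits (const undecided) v k)
  apart′ {i} {k} i≢k (∈i , ∈k) with ℕ.<-cmp (toℕ i) (toℕ k)
  ... | tri< i<k _ _ = below i<k (∈i , ∈k)
  ... | tri≈ _ i≡k _ = i≢k (toℕ-injective i≡k)
  ... | tri> _ _ k<i = below k<i (∈k , ∈i)

-- Disjointness is stated through `False`, a boolean test with at most one proof, so `Pairs n` has
-- one element per valid family.
ValidFamily-irrelevant : ∀ {n} {v : Family n} (f g : ValidFamily v) → f ≡ g
ValidFamily-irrelevant (p , q) (p′ , q′) = cong₂ _,_ (All.irrelevant IsRPath-irrelevant p p′)
  (AllPairs.irrelevant (All.irrelevant (All.irrelevant T-irrelevant)) q q′)

theorem4p1 : (S : ℕ → ℕ → ℕ) → (∀ i j → Fin (S i j) ↔ RPath i j) →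
    (n : ℕ) → 1 ≤ n → (t : ℕ) → Fin t ↔ Pairs n →
    + t ≡ det n (IplusM S n)
theorem4p1 S S↔ n _ t t↔ with counted-all-undecided n
-- `count-↔` is used twice: it identifies `t` with the number of families, and each value of `S`
-- with the number of walks in the matrix.
... | c , C , c≡det = trans
  (cong +_ (count-↔ (λ {v} → ValidFamily-irrelevant {v = v}) (count-⇔ (λ {v} → valid⇒validFamily {v = v}) (λ {v} → validFamily⇒valid {v = v}) C) t↔))
  (trans c≡det (det-cong λ i j → cong (λ s → identity n i j + + s)
    (sym (count-↔ IsRPath-irrelevant (count-rpath (toℕ i) (toℕ j)) (S↔ (toℕ i) (suc (toℕ j)))))))
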